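{- Let $n \in \mathbb{N}$ be an odd perfect square. Then there is no solution $\mathbf{u} = (u_1,u_2,u_3) \in \mathbb{N}^3$ to $$\frac{4}{n} = \frac{1}{u_1} + \frac{1}{u_2} + \frac{1}{u_3}$$ satisfying either (1) $n \mid u_1$ and $\gcd(n, u_2u_3) = 1$; or (2) $\gcd(n,u_1) = 1$, $n \mid u_2$ and $n \mid u_3$.
   Context: $\mathbb{N}$ denotes the positive integers. -}

module Defs where

{-# OPTIONS --safe #-}
module Submission where

-- Clearing denominators and extracting common factors, a solution of either kind yields
-- positive integers with ce = a + b and 4abd = 1 + ne in case (1), 4abd = n + e in case (2).
-- If n = m², then -d is a square modulo e and -e is a square modulo 4d, which contradicts
-- quadratic reciprocity. Reciprocity is avoided: the two congruences define a lattice on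
-- which X² + 4dY² + eZ² is 4de times a positive definite integral ternary form of
-- determinant 1 (up to normalisation), and Hermite reduction shows that none exists.

module TernaryForms where

  open import Data.Nat.Base as ℕ using (ℕ; zero; suc)
  import Data.Nat.Properties as ℕ
  open import Data.Nat.GCD using (module Bézout)
  open import Data.Integer.Base hiding (suc)
  open import Data.Integer.Properties
  open import Data.Integer.DivMod using (_/ℕ_; _%ℕ_; a≡a%ℕn+[a/ℕn]*n; n%ℕd<d)
  open import Data.Integer.Tactic.RingSolver using (ring; solve-∀)
  open import Data.Empty using (⊥)
  open import Data.Product.Base using (_×_; _,_; ∃-syntax)
  open import Data.Sum.Base using (_⊎_; inj₁; inj₂)
  open import Relation.Binary.PropositionalEquality
  open import Relation.Nullary.Decidable.Core using (yes; no)
  open import Relation.Nullary.Negation.Core using (¬_)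
  open import Tactic.RingSolver.NonReflective ring using (Expr; Κ; _⊕_; _⊗_; ⊝_; _⊜_; solve)

  -- Signs of sums and products of integers, and rounding.

  +n≥0 : ∀ {n} → 0ℤ ≤ + n
  +n≥0 = +≤+ ℕ.z≤n

  +[1+n]>0 : ∀ {n} → 0ℤ < +[1+ n ]
  +[1+n]>0 = +<+ (ℕ.s≤s ℕ.z≤n)

  i≥0∧j≥0⇒i+j≥0 : ∀ {i j} → 0ℤ ≤ i → 0ℤ ≤ j → 0ℤ ≤ i + j
  i≥0∧j≥0⇒i+j≥0 = +-mono-≤

  i≥0∧j≥0⇒i*j≥0 : ∀ {i j} → 0ℤ ≤ i → 0ℤ ≤ j → 0ℤ ≤ i * j
  i≥0∧j≥0⇒i*j≥0 {i} {j} i≥0 j≥0 =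
    subst (_≤ i * j) (*-zeroʳ i) (*-monoˡ-≤-nonNeg i {{nonNegative i≥0}} j≥0)

  i*i≥0 : ∀ i → 0ℤ ≤ i * i
  i*i≥0 (+ n)    = i≥0∧j≥0⇒i*j≥0 {+ n} {+ n} +n≥0 +n≥0
  i*i≥0 -[1+ n ] = +n≥0

  *-cancelˡ->0 : ∀ {i j} → 0ℤ < i → 0ℤ < i * j → 0ℤ < j
  *-cancelˡ->0 {i} {j} i>0 i*j>0 =
    *-cancelˡ-<-nonNeg i {{nonNegative (<⇒≤ i>0)}} (subst (_< i * j) (sym (*-zeroʳ i)) i*j>0)

  -w≤k≤w⇒w*w≤k*k : ∀ w k → 0ℤ ≤ k - w → 0ℤ ≤ k + w → w * w ≤ k * k
  -w≤k≤w⇒w*w≤k*k w k k-w≥0 k+w≥0 =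
    0≤i-j⇒j≤i (subst (0ℤ ≤_) (factor k w) (i≥0∧j≥0⇒i*j≥0 k-w≥0 k+w≥0))
    where
    factor : ∀ k w → (k - w) * (k + w) ≡ k * k - w * w
    factor = solve-∀

  -- The residue of `v` modulo `2k` of least absolute value lies between `-k` and `k`. The bound is
  -- squared to fit `disc`, where the mixed coefficient enters only through its square.
  nearest-multiple : ∀ v {k} → 0ℤ < k →
    ∃[ t ] (v + + 2 * (k * t)) * (v + + 2 * (k * t)) ≤ k * k
  nearest-multiple v {+ zero}  (+<+ ())
  nearest-multiple v {+ suc m} _ = round (ℕ.≤-total ρ (suc m))
    where
    ρ = v %ℕ (2 ℕ.* suc m)
    τ = v /ℕ (2 ℕ.* suc m)
    k = + suc m

    v≡ρ+2kτ : v ≡ + ρ + τ * (+ 2 * k)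
    v≡ρ+2kτ = a≡a%ℕn+[a/ℕn]*n v (2 ℕ.* suc m)

    move : ∀ ρ k τ t → (ρ + τ * (+ 2 * k)) + + 2 * (k * t) ≡ ρ + + 2 * (k * (t + τ))
    move = solve-∀

    remainder : ∀ {t w} → + ρ + + 2 * (k * (t + τ)) ≡ w → w * w ≤ k * k →
      (v + + 2 * (k * t)) * (v + + 2 * (k * t)) ≤ k * k
    remainder {t} eq = subst (λ w → w * w ≤ k * k)
      (sym (trans (cong (_+ + 2 * (k * t)) v≡ρ+2kτ) (trans (move (+ ρ) k τ t) eq)))

    down : ∀ ρ k τ → ρ + + 2 * (k * (- τ + τ)) ≡ ρ
    down = solve-∀

    up : ∀ ρ k τ → ρ + + 2 * (k * ((- τ - + 1) + τ)) ≡ ρ - + 2 * k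
    up = solve-∀

    k-[ρ-2k]≡ : ∀ ρ k → k + (+ 2 * k - ρ) ≡ k - (ρ - + 2 * k)
    k-[ρ-2k]≡ = solve-∀

    k+[ρ-2k]≡ : ∀ ρ k → ρ - k ≡ k + (ρ - + 2 * k)
    k+[ρ-2k]≡ = solve-∀

    round : ρ ℕ.≤ suc m ⊎ suc m ℕ.≤ ρ →
      ∃[ t ] (v + + 2 * (k * t)) * (v + + 2 * (k * t)) ≤ k * k
    round (inj₁ ρ≤k) = - τ , remainder (down (+ ρ) k τ)
      (-w≤k≤w⇒w*w≤k*k (+ ρ) k (i≤j⇒0≤j-i (+≤+ ρ≤k)) +n≥0)
    -- A remainder in the upper half, `k ≤ ρ < 2k`, is moved down by `2k` once more, to between `-k`
    -- and `0`.
    round (inj₂ k≤ρ) = - τ - + 1 , remainder (up (+ ρ) k τ)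
      (-w≤k≤w⇒w*w≤k*k (+ ρ - + 2 * k) k
        (subst (0ℤ ≤_) (k-[ρ-2k]≡ (+ ρ) k)
          (i≥0∧j≥0⇒i+j≥0 {k} +n≥0 (i≤j⇒0≤j-i (+≤+ (ℕ.<⇒≤ (n%ℕd<d v (2 ℕ.* suc m)))))))
        (subst (0ℤ ≤_) (k+[ρ-2k]≡ (+ ρ) k) (i≤j⇒0≤j-i (+≤+ k≤ρ))))

  -- Reduction of positive definite ternary forms of determinant 1.

  -- Minus the usual discriminant of `aX² + rXY + bY²`, hence positive when that binary form is
  -- definite.
  disc : (a b r : ℤ) → ℤ
  disc a b r = + 4 * (a * b) - r * r

  -- Half the determinant of the Hessian of aX² + bY² + cZ² + pYZ + qXZ + rXY.
  det : (a b c p q r : ℤ) → ℤ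
  det a b c p q r = + 4 * (a * b * c) + p * q * r - a * (p * p) - b * (q * q) - c * (r * r)

  -- The ring solver does not unfold disc and det, so it is given syntactic copies of them.
  discᴱ : ∀ {n} (a b r : Expr ℤ n) → Expr ℤ n
  discᴱ a b r = Κ (+ 4) ⊗ (a ⊗ b) ⊕ ⊝ (r ⊗ r)

  detᴱ : ∀ {n} (a b c p q r : Expr ℤ n) → Expr ℤ n
  detᴱ a b c p q r =
    Κ (+ 4) ⊗ (a ⊗ b ⊗ c) ⊕ p ⊗ q ⊗ r ⊕ ⊝ (a ⊗ (p ⊗ p)) ⊕ ⊝ (b ⊗ (q ⊗ q)) ⊕ ⊝ (c ⊗ (r ⊗ r))

  -- By Sylvester's criterion the sign conditions say that the form is positive definite.
  record UnimodularForm (a b : ℤ) : Set where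
    field
      c p q r : ℤ
      a>0     : 0ℤ < a
      disc>0  : 0ℤ < disc a b r
      det≡1   : det a b c p q r ≡ 1ℤ

  disc>0⇒b>0 : ∀ {a b} r → 0ℤ < a → 0ℤ < disc a b r → 0ℤ < b
  disc>0⇒b>0 {a} {b} r a>0 d>0 = *-cancelˡ->0 a>0 (*-cancelˡ->0 {+ 4} +[1+n]>0
    (subst (0ℤ <_) (restore a b r) (+-mono-<-≤ d>0 (i*i≥0 r))))
    where
    restore : ∀ a b r → (+ 4 * (a * b) - r * r) + r * r ≡ + 4 * (a * b)
    restore = solve-∀

  swapXY : ∀ {a b} → UnimodularForm a b → UnimodularForm b a
  swapXY {a} {b} F = record
    { c = c ; p = q ; q = p ; r = r
    ; a>0    = disc>0⇒b>0 r a>0 disc>0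
    ; disc>0 = subst (0ℤ <_) (disc-swap a b r) disc>0
    ; det≡1  = trans (det-swap a b c p q r) det≡1
    }
    where
    open UnimodularForm F

    disc-swap : ∀ a b r → disc a b r ≡ disc b a r
    disc-swap = solve 3 (λ a b r → discᴱ a b r ⊜ discᴱ b a r) refl

    det-swap : ∀ a b c p q r → det b a c q p r ≡ det a b c p q r
    det-swap = solve 6 (λ a b c p q r → detᴱ b a c q p r ⊜ detᴱ a b c p q r) refl

  -- Adding `t` times the first basis vector to the second preserves `disc` and `det`, and
  -- `4a(b - b′) = r² - r′²`. Bringing `|r|` from above `a` to at most `a` therefore lowers `b`.
  shear : ∀ {a b} (F : UnimodularForm a b) → let r = UnimodularForm.r F in
    a * a < r * r → ∃[ b′ ] b′ < b × UnimodularForm a b′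
  shear {a} {b} F a²<r² with nearest-multiple (UnimodularForm.r F) (UnimodularForm.a>0 F)
  ... | t , r′²≤a² = b′ , b′<b , record
    { c = c ; p = p + q * t ; q = q ; r = r′
    ; a>0    = a>0
    ; disc>0 = subst (0ℤ <_) (sym (disc-shear a b r t)) disc>0
    ; det≡1  = trans (det-shear a b c p q r t) det≡1
    }
    where
    open UnimodularForm F
    b′ = b + r * t + a * (t * t)
    r′ = r + + 2 * (a * t)

    disc-shear : ∀ a b r t →
      disc a (b + r * t + a * (t * t)) (r + + 2 * (a * t)) ≡ disc a b r
    disc-shear = solve 4 (λ a b r t →
      discᴱ a (b ⊕ r ⊗ t ⊕ a ⊗ (t ⊗ t)) (r ⊕ Κ (+ 2) ⊗ (a ⊗ t)) ⊜ discᴱ a b r) refl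

    det-shear : ∀ a b c p q r t →
      det a (b + r * t + a * (t * t)) c (p + q * t) q (r + + 2 * (a * t)) ≡ det a b c p q r
    det-shear = solve 7 (λ a b c p q r t →
      detᴱ a (b ⊕ r ⊗ t ⊕ a ⊗ (t ⊗ t)) c (p ⊕ q ⊗ t) q (r ⊕ Κ (+ 2) ⊗ (a ⊗ t))
        ⊜ detᴱ a b c p q r) refl

    drop : ∀ a b r t →
      r * r - (r + + 2 * (a * t)) * (r + + 2 * (a * t))
        ≡ + 4 * (a * (b - (b + r * t + a * (t * t))))
    drop = solve-∀

    b′<b : b′ < b
    b′<b = 0<i-j⇒j<i (*-cancelˡ->0 a>0 (*-cancelˡ->0 {+ 4} +[1+n]>0
      (subst (0ℤ <_) (drop a b r t) (i<j⇒0<j-i (≤-<-trans r′²≤a² a²<r²)))))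
      where
      i<j⇒0<j-i : ∀ {i j} → i < j → 0ℤ < j - i
      i<j⇒0<j-i {i} {j} i<j = subst (_< j - i) (+-inverseʳ i) (+-monoˡ-< (- i) i<j)

      0<i-j⇒j<i : ∀ {i j} → 0ℤ < i - j → j < i
      0<i-j⇒j<i {i} {j} 0<i-j = ≰⇒> λ i≤j → <⇒≱ 0<i-j (i≤j⇒i-j≤0 i≤j)

  -- The third basis vector is translated by the first two until it is nearly orthogonal to
  -- them; since det ≡ 1, its value is then below b and it can become the second one.
  replaceY : ∀ {a b} (F : UnimodularForm a b) → let r = UnimodularForm.r F in
    r * r ≤ a * a → a ≤ b → ∃[ b′ ] b′ < b × UnimodularForm a b′
  replaceY {a} {b} F r²≤a² a≤b
    -- Adding `x` times the first and `y` times the second vector to the third changes `2ap - qr` by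
    -- `Δy`, whatever `x` is, so `y` is chosen first. The doubling matches the steps of `2Δ` in
    -- `nearest-multiple`.
    with nearest-multiple (+ 2 * (+ 2 * (a * p) - q * r)) disc>0
    where open UnimodularForm F
  ... | y , M²≤Δ² with nearest-multiple (q + r * y) a>0
    where open UnimodularForm F
  ... | x , q′²≤a² = c′ , c′<b , record
    -- The translated third vector and the second one trade places, so the XZ coefficient is now `r`
    -- and the XY coefficient `q′`.
    { c = b ; p = p + + 2 * (b * y) + r * x ; q = r ; r = q′
    ; a>0    = a>0
    ; disc>0 = disc′>0
    ; det≡1  = trans (det-replace a b c p q r x y) det≡1
    }
    where
    open UnimodularForm F
    Δ = disc a b r
    M = + 2 * (+ 2 * (a * p) - q * r) + + 2 * (Δ * y)
    c′ = c + a * (x * x) + b * (y * y) + r * (x * y) + p * y + q * x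
    q′ = q + r * y + + 2 * (a * x)
    Δ′ = disc a c′ q′

    det-replace : ∀ a b c p q r x y →
      det a (c + a * (x * x) + b * (y * y) + r * (x * y) + p * y + q * x) b
        (p + + 2 * (b * y) + r * x) r (q + r * y + + 2 * (a * x)) ≡ det a b c p q r
    det-replace = solve 8 (λ a b c p q r x y →
      detᴱ a (c ⊕ a ⊗ (x ⊗ x) ⊕ b ⊗ (y ⊗ y) ⊕ r ⊗ (x ⊗ y) ⊕ p ⊗ y ⊕ q ⊗ x) b
        (p ⊕ Κ (+ 2) ⊗ (b ⊗ y) ⊕ r ⊗ x) r (q ⊕ r ⊗ y ⊕ Κ (+ 2) ⊗ (a ⊗ x))
        ⊜ detᴱ a b c p q r) refl

    -- The Desnanot-Jacobi identity for the Hessian, times 4: the two values of `disc` are principal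
    -- minors sharing the entry `2a`, half of `M` is the mixed minor, and the full determinant is
    -- `2 det`.
    jacobi : ∀ a b c p q r x y →
      + 4 * (disc a b r * disc a
        (c + a * (x * x) + b * (y * y) + r * (x * y) + p * y + q * x) (q + r * y + + 2 * (a * x)))
      ≡ (+ 2 * (+ 2 * (a * p) - q * r) + + 2 * (disc a b r * y))
          * (+ 2 * (+ 2 * (a * p) - q * r) + + 2 * (disc a b r * y))
        + + 16 * (a * det a b c p q r)
    jacobi = solve 8 (λ a b c p q r x y →
      Κ (+ 4) ⊗ (discᴱ a b r ⊗ discᴱ a
        (c ⊕ a ⊗ (x ⊗ x) ⊕ b ⊗ (y ⊗ y) ⊕ r ⊗ (x ⊗ y) ⊕ p ⊗ y ⊕ q ⊗ x)
        (q ⊕ r ⊗ y ⊕ Κ (+ 2) ⊗ (a ⊗ x)))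
      ⊜ ((Κ (+ 2) ⊗ (Κ (+ 2) ⊗ (a ⊗ p) ⊕ ⊝ (q ⊗ r)) ⊕ Κ (+ 2) ⊗ (discᴱ a b r ⊗ y))
          ⊗ (Κ (+ 2) ⊗ (Κ (+ 2) ⊗ (a ⊗ p) ⊕ ⊝ (q ⊗ r)) ⊕ Κ (+ 2) ⊗ (discᴱ a b r ⊗ y))
        ⊕ Κ (+ 16) ⊗ (a ⊗ detᴱ a b c p q r))) refl

    4ΔΔ′≡M²+16a : + 4 * (Δ * Δ′) ≡ M * M + + 16 * a
    4ΔΔ′≡M²+16a = trans (jacobi a b c p q r x y)
      (cong (λ d → M * M + + 16 * d) (trans (cong (a *_) det≡1) (*-identityʳ a)))

    16a>0 : 0ℤ < + 16 * a
    16a>0 = *-monoˡ-<-pos (+ 16) a>0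

    disc′>0 : 0ℤ < Δ′
    disc′>0 = *-cancelˡ->0 disc>0 (*-cancelˡ->0 {+ 4} +[1+n]>0
      (subst (0ℤ <_) (sym 4ΔΔ′≡M²+16a) (+-mono-≤-< (i*i≥0 M) 16a>0)))

    -- The right-hand side vanishes, whereas for b ≤ c′ the summands on the left are
    -- nonnegative and the last one is positive.
    surplus : ∀ a b c′ q′ M Δ →
      + 4 * (Δ * (+ 4 * (a * (c′ - b)) + (a * a - q′ * q′))) + (Δ * Δ - M * M)
        + Δ * (+ 4 * (a * b) - Δ) + + 4 * (a * (Δ * (+ 3 * b - a) - + 4))
      ≡ + 4 * (Δ * (+ 4 * (a * c′) - q′ * q′)) - (M * M + + 16 * a)
    surplus = solve-∀

    4ab-Δ≡r² : ∀ a b r → + 4 * (a * b) - disc a b r ≡ r * r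
    4ab-Δ≡r² = solve 3 (λ a b r → Κ (+ 4) ⊗ (a ⊗ b) ⊕ ⊝ discᴱ a b r ⊜ r ⊗ r) refl

    Δ-3≡ : ∀ a b r →
      + 4 * (a * (b - a)) + (a * a - r * r) + + 3 * ((a - + 1) * (a - + 1) + + 2 * (a - + 1))
        ≡ disc a b r - + 3
    Δ-3≡ = solve 3 (λ a b r →
      Κ (+ 4) ⊗ (a ⊗ (b ⊕ ⊝ a)) ⊕ (a ⊗ a ⊕ ⊝ (r ⊗ r))
        ⊕ Κ (+ 3) ⊗ ((a ⊕ ⊝ Κ (+ 1)) ⊗ (a ⊕ ⊝ Κ (+ 1)) ⊕ Κ (+ 2) ⊗ (a ⊕ ⊝ Κ (+ 1)))
        ⊜ (discᴱ a b r ⊕ ⊝ Κ (+ 3))) refl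

    Δ[3b-a]-4≡ : ∀ a b Δ →
      (Δ - + 3) * (+ 3 * (b - a) + + 2 * a) + (+ 9 * (b - a) + + 6 * (a - + 1)) + + 2
        ≡ Δ * (+ 3 * b - a) - + 4
    Δ[3b-a]-4≡ = solve-∀

    a≥0 : 0ℤ ≤ a
    a≥0 = <⇒≤ a>0

    a-1≥0 : 0ℤ ≤ a - 1ℤ
    a-1≥0 = i≤j⇒0≤j-i (i<j⇒suc[i]≤j a>0)

    b-a≥0 : 0ℤ ≤ b - a
    b-a≥0 = i≤j⇒0≤j-i a≤b

    _⊹_ = i≥0∧j≥0⇒i+j≥0
    _·_ = i≥0∧j≥0⇒i*j≥0

    -- `Δ = 4ab - r² ≥ 3a² ≥ 3`, since `r² ≤ a² ≤ ab` and `a ≥ 1`.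
    Δ-3≥0 : 0ℤ ≤ Δ - + 3
    Δ-3≥0 = subst (0ℤ ≤_) (Δ-3≡ a b r)
      (((+n≥0 {4} · (a≥0 · b-a≥0)) ⊹ i≤j⇒0≤j-i r²≤a²)
        ⊹ (+n≥0 {3} · ((a-1≥0 · a-1≥0) ⊹ (+n≥0 {2} · a-1≥0))))

    -- `Δ ≥ 3` and `3b - a ≥ 2a ≥ 2` make the product at least 6.
    Δ[3b-a]-4>0 : 0ℤ < Δ * (+ 3 * b - a) - + 4
    Δ[3b-a]-4>0 = subst (0ℤ <_) (Δ[3b-a]-4≡ a b Δ) (+-mono-≤-<
      ((Δ-3≥0 · ((+n≥0 {3} · b-a≥0) ⊹ (+n≥0 {2} · a≥0)))
        ⊹ ((+n≥0 {9} · b-a≥0) ⊹ (+n≥0 {6} · a-1≥0)))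
      +[1+n]>0)

    b≰c′ : ¬ b ≤ c′
    b≰c′ b≤c′ = <-irrefl (sym (trans (surplus a b c′ q′ M Δ) (i≡j⇒i-j≡0 4ΔΔ′≡M²+16a)))
      (+-mono-≤-<
        (((+n≥0 {4} · (<⇒≤ disc>0 ·
            ((+n≥0 {4} · (a≥0 · i≤j⇒0≤j-i b≤c′)) ⊹ i≤j⇒0≤j-i q′²≤a²)))
          ⊹ i≤j⇒0≤j-i M²≤Δ²)
          ⊹ (<⇒≤ disc>0 · subst (0ℤ ≤_) (sym (4ab-Δ≡r² a b r)) (i*i≥0 r)))
        (*-monoˡ-<-pos (+ 4) (subst (_< a * (Δ * (+ 3 * b - a) - + 4)) (*-zeroʳ a)
          (*-monoˡ-<-pos a {{positive a>0}} Δ[3b-a]-4>0))))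

    c′<b : c′ < b
    c′<b = ≰⇒> b≰c′

  -- If `|r| > a`, the first vector can be used to shorten the second. Otherwise the binary form in
  -- X and Y is reduced, and determinant 1 forces a translate of the third vector to be shorter than
  -- the second.
  descend : ∀ {a b} → UnimodularForm a b → a ≤ b → ∃[ b′ ] b′ < b × UnimodularForm a b′
  descend {a} F a≤b with UnimodularForm.r F * UnimodularForm.r F ≤? a * a
  ... | yes r²≤a² = replaceY F r²≤a² a≤b
  ... | no  r²≰a² = shear F (≰⇒> r²≰a²)

  -- Infinite descent on `a + b`, which positive definiteness keeps positive: each round lowers the
  -- larger of the two and fixes the other, after a swap if `b ≤ a`.
  ¬unimodularForm-bounded : ∀ n {a b} → a + b ≤ + n → ¬ UnimodularForm a b
  ¬unimodularForm-bounded zero a+b≤0 F =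
    <⇒≱ (+-mono-< a>0 (disc>0⇒b>0 r a>0 disc>0)) a+b≤0
    where open UnimodularForm F
  ¬unimodularForm-bounded (suc n) {a} {b} a+b≤1+n F with ≤-total a b
  ... | inj₁ a≤b with descend F a≤b
  ...   | b′ , b′<b , F′ = ¬unimodularForm-bounded n
          (i<j⇒i≤pred[j] (<-≤-trans (+-monoʳ-< a b′<b) a+b≤1+n)) F′
  ¬unimodularForm-bounded (suc n) {a} {b} a+b≤1+n F | inj₂ b≤a with descend (swapXY F) b≤a
  ...   | a′ , a′<a , F′ = ¬unimodularForm-bounded n
          (i<j⇒i≤pred[j] (<-≤-trans (+-monoʳ-< b a′<a) (subst (_≤ + suc n) (+-comm a b) a+b≤1+n))) F′

  ¬unimodularForm : ∀ {a b} → ¬ UnimodularForm a b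
  ¬unimodularForm {a} {b} = ¬unimodularForm-bounded ∣ a + b ∣ {a} {b} (i≤+∣i∣ (a + b))
    where
    i≤+∣i∣ : ∀ i → i ≤ + ∣ i ∣
    i≤+∣i∣ (+ n)    = ≤-refl
    i≤+∣i∣ -[1+ n ] = -≤+

  -- From square conditions modulo `e` and `4d` to a form of determinant 1.

  -- The three equations make X² + 4dY² + eZ² divisible by 4de on the lattice spanned by
  -- (0,e,0), (2d,α,0), (β,γ,1), and the quotient eX² + FY² + CZ² + KYZ + 2γXZ + 2αXY has
  -- determinant 1. In terms of congruences they say α² ≡ -d (mod e), β² ≡ -e (mod 4d).
  ¬-d≡□∧-e≡□ : ∀ {d e} α β γ F K C → 0ℤ < d → 0ℤ < e →
    e * F ≡ d + α * α →
    e * K ≡ β + + 2 * (α * γ) →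
    + 4 * (d * (e * C)) ≡ β * β + + 4 * (d * (γ * γ)) + e →
    ⊥
  ¬-d≡□∧-e≡□ {d} {e} α β γ F K C d>0 e>0 eF≡ eK≡ 4deC≡ = ¬unimodularForm record
    { c = C ; p = K ; q = + 2 * γ ; r = + 2 * α
    ; a>0    = e>0
    ; disc>0 = subst (0ℤ <_) (sym disc≡4d) (*-monoˡ-<-pos (+ 4) d>0)
    ; det≡1  = *-cancelˡ-≡ e _ 1ℤ {{>-nonZero e>0}} (trans e*det≡e (sym (*-identityʳ e)))
    }
    where
    disc-eF : ∀ e F α → disc e F (+ 2 * α) ≡ + 4 * (e * F - α * α)
    disc-eF = solve 3 (λ e F α →
      discᴱ e F (Κ (+ 2) ⊗ α) ⊜ Κ (+ 4) ⊗ (e ⊗ F ⊕ ⊝ (α ⊗ α))) refl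

    cancel : ∀ d s → + 4 * (d + s - s) ≡ + 4 * d
    cancel = solve-∀

    disc≡4d : disc e F (+ 2 * α) ≡ + 4 * d
    disc≡4d = trans (disc-eF e F α)
      (trans (cong (λ x → + 4 * (x - α * α)) eF≡) (cancel d (α * α)))

    -- The hypotheses evaluate `eF` and `eK` rather than `F` and `K`. Multiplied by `e`, the
    -- determinant involves only these products and `eC`; the factor `e` is cancelled in `det≡1`.
    det-eF-eK : ∀ e F C K γ α → e * det e F C K (+ 2 * γ) (+ 2 * α) ≡
      + 4 * (e * C * (e * F - α * α)) + + 4 * (α * γ * (e * K)) - e * K * (e * K)
        - + 4 * (γ * γ * (e * F))
    det-eF-eK = solve 6 (λ e F C K γ α → e ⊗ detᴱ e F C K (Κ (+ 2) ⊗ γ) (Κ (+ 2) ⊗ α) ⊜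
      (Κ (+ 4) ⊗ (e ⊗ C ⊗ (e ⊗ F ⊕ ⊝ (α ⊗ α))) ⊕ Κ (+ 4) ⊗ (α ⊗ γ ⊗ (e ⊗ K))
        ⊕ ⊝ (e ⊗ K ⊗ (e ⊗ K)) ⊕ ⊝ (Κ (+ 4) ⊗ (γ ⊗ γ ⊗ (e ⊗ F))))) refl

    expand : ∀ d eC α β γ →
      + 4 * (eC * (d + α * α - α * α)) + + 4 * (α * γ * (β + + 2 * (α * γ)))
        - (β + + 2 * (α * γ)) * (β + + 2 * (α * γ)) - + 4 * (γ * γ * (d + α * α))
      ≡ + 4 * (d * eC) - (β * β + + 4 * (d * (γ * γ)))
    expand = solve-∀

    drop : ∀ s e → s + e - s ≡ e
    drop = solve-∀

    e*det≡e : e * det e F C K (+ 2 * γ) (+ 2 * α) ≡ e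
    e*det≡e = begin
      e * det e F C K (+ 2 * γ) (+ 2 * α)
        ≡⟨ det-eF-eK e F C K γ α ⟩
      + 4 * (e * C * (e * F - α * α)) + + 4 * (α * γ * (e * K)) - e * K * (e * K)
        - + 4 * (γ * γ * (e * F))
        ≡⟨ cong₂ (λ x y → + 4 * (e * C * (x - α * α)) + + 4 * (α * γ * y) - y * y
                            - + 4 * (γ * γ * x)) eF≡ eK≡ ⟩
      + 4 * (e * C * (d + α * α - α * α)) + + 4 * (α * γ * (β + + 2 * (α * γ)))
        - (β + + 2 * (α * γ)) * (β + + 2 * (α * γ)) - + 4 * (γ * γ * (d + α * α))
        ≡⟨ expand d (e * C) α β γ ⟩
      + 4 * (d * (e * C)) - (β * β + + 4 * (d * (γ * γ)))
        ≡⟨ cong (_- (β * β + + 4 * (d * (γ * γ)))) 4deC≡ ⟩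
      β * β + + 4 * (d * (γ * γ)) + e - (β * β + + 4 * (d * (γ * γ)))
        ≡⟨ drop (β * β + + 4 * (d * (γ * γ))) e ⟩
      e ∎
      where open ≡-Reasoning

  -- Modulo `e`, `a ≡ -b` gives `-4b²d ≡ 1`, so `(2bd)² ≡ -d`. Modulo `4d`, `m²e ≡ -1`, so
  -- `(me)² ≡ -e`. As `β = me` is already a multiple of `e`, `γ = 0` suffices.
  ¬4abd≡1+m²e : ∀ {a b c d e m} → 0ℤ < d → 0ℤ < e → c * e ≡ a + b →
    ¬ + 4 * (a * b * d) ≡ 1ℤ + m * m * e
  ¬4abd≡1+m²e {a} {b} {c} {d} {e} {m} d>0 e>0 ce≡a+b 4abd≡ =
    ¬-d≡□∧-e≡□ (+ 2 * (b * d)) (m * e) 0ℤ (d * (+ 4 * (b * c * d) - m * m)) m (a * b)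
      d>0 e>0 eF≡ (commute b d e m) 4deC≡
    where
    open ≡-Reasoning

    commute : ∀ b d e m → e * m ≡ m * e + + 2 * (+ 2 * (b * d) * + 0)
    commute = solve-∀

    eF-ce : ∀ b c d e m →
      e * (d * (+ 4 * (b * c * d) - m * m)) ≡ d * (+ 4 * (b * (c * e) * d) - m * m * e)
    eF-ce = solve-∀

    split : ∀ a b d s → d * (+ 4 * (b * (a + b) * d) - s) ≡
      d * (+ 4 * (a * b * d) - s) + + 2 * (b * d) * (+ 2 * (b * d))
    split = solve-∀

    unit : ∀ d s t → d * (+ 1 + s - s) + t ≡ d + t
    unit = solve-∀

    eF≡ : e * (d * (+ 4 * (b * c * d) - m * m)) ≡ d + + 2 * (b * d) * (+ 2 * (b * d))
    eF≡ = begin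
      e * (d * (+ 4 * (b * c * d) - m * m))
        ≡⟨ eF-ce b c d e m ⟩
      d * (+ 4 * (b * (c * e) * d) - m * m * e)
        ≡⟨ cong (λ x → d * (+ 4 * (b * x * d) - m * m * e)) ce≡a+b ⟩
      d * (+ 4 * (b * (a + b) * d) - m * m * e)
        ≡⟨ split a b d (m * m * e) ⟩
      d * (+ 4 * (a * b * d) - m * m * e) + + 2 * (b * d) * (+ 2 * (b * d))
        ≡⟨ cong (λ x → d * (x - m * m * e) + + 2 * (b * d) * (+ 2 * (b * d))) 4abd≡ ⟩
      d * (1ℤ + m * m * e - m * m * e) + + 2 * (b * d) * (+ 2 * (b * d))
        ≡⟨ unit d (m * m * e) (+ 2 * (b * d) * (+ 2 * (b * d))) ⟩
      d + + 2 * (b * d) * (+ 2 * (b * d)) ∎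

    gather : ∀ a b d e → + 4 * (d * (e * (a * b))) ≡ e * (+ 4 * (a * b * d))
    gather = solve-∀

    square : ∀ d e m → e * (+ 1 + m * m * e) ≡ m * e * (m * e) + + 4 * (d * (+ 0 * + 0)) + e
    square = solve-∀

    4deC≡ : + 4 * (d * (e * (a * b))) ≡ m * e * (m * e) + + 4 * (d * (0ℤ * 0ℤ)) + e
    4deC≡ = trans (gather a b d e) (trans (cong (e *_) 4abd≡) (square d e m))

  -- Here `u` inverts `m` modulo `e`. Modulo `e`, `b ≡ -a` gives `-4a²d ≡ m²`, so `(2adu)² ≡ -d`.
  -- Modulo `4d`, `m² ≡ -e`.
  ¬4abd≡m²+e : ∀ {a b c d e m u v} → 0ℤ < d → 0ℤ < e → u * m ≡ 1ℤ + e * v → c * e ≡ a + b →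
    ¬ + 4 * (a * b * d) ≡ m * m + e
  ¬4abd≡m²+e {a} {b} {c} {d} {e} {m} {u} {v} d>0 e>0 um≡1+ev ce≡a+b 4abd≡ =
    -- With `β = m`, the choice `γ = a` makes `β + 2αγ = m + 4a²du ≡ m - m²u ≡ 0` modulo `e`. The
    -- quotients by `e` come from replacing `um` by `1 + ev`.
    ¬-d≡□∧-e≡□ (+ 2 * (a * d * u)) m a (d * (u * u * f - v * (+ 2 + e * v))) (u * f - m * v) (a * c)
      d>0 e>0 eF≡ eK≡ 4deC≡
    where
    open ≡-Reasoning
    f = + 4 * (a * c * d) - 1ℤ

    ef-ce : ∀ a c d e → e * (+ 4 * (a * c * d) - + 1) ≡ + 4 * (a * (c * e) * d) - e
    ef-ce = solve-∀

    split : ∀ a b d e → + 4 * (a * (a + b) * d) - e ≡ + 4 * (a * b * d) - e + + 4 * (a * a * d)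
    split = solve-∀

    cancel : ∀ s e t → s + e - e + t ≡ s + t
    cancel = solve-∀

    ef≡ : e * f ≡ m * m + + 4 * (a * a * d)
    ef≡ = begin
      e * f
        ≡⟨ ef-ce a c d e ⟩
      + 4 * (a * (c * e) * d) - e
        ≡⟨ cong (λ x → + 4 * (a * x * d) - e) ce≡a+b ⟩
      + 4 * (a * (a + b) * d) - e
        ≡⟨ split a b d e ⟩
      + 4 * (a * b * d) - e + + 4 * (a * a * d)
        ≡⟨ cong (λ x → x - e + + 4 * (a * a * d)) 4abd≡ ⟩
      m * m + e - e + + 4 * (a * a * d)
        ≡⟨ cancel (m * m) e (+ 4 * (a * a * d)) ⟩
      m * m + + 4 * (a * a * d) ∎

    eF-ef : ∀ d e f u v → e * (d * (u * u * f - v * (+ 2 + e * v))) ≡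
      d * (u * u * (e * f) + + 1 - (+ 1 + e * v) * (+ 1 + e * v))
    eF-ef = solve-∀

    complete : ∀ a d m u → d * (u * u * (m * m + + 4 * (a * a * d)) + + 1 - u * m * (u * m)) ≡
      d + + 2 * (a * d * u) * (+ 2 * (a * d * u))
    complete = solve-∀

    eF≡ : e * (d * (u * u * f - v * (+ 2 + e * v))) ≡ d + + 2 * (a * d * u) * (+ 2 * (a * d * u))
    eF≡ = begin
      e * (d * (u * u * f - v * (+ 2 + e * v)))
        ≡⟨ eF-ef d e f u v ⟩
      d * (u * u * (e * f) + 1ℤ - (1ℤ + e * v) * (1ℤ + e * v))
        ≡⟨ cong₂ (λ x y → d * (u * u * x + 1ℤ - y * y)) ef≡ (sym um≡1+ev) ⟩
      d * (u * u * (m * m + + 4 * (a * a * d)) + 1ℤ - u * m * (u * m))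
        ≡⟨ complete a d m u ⟩
      d + + 2 * (a * d * u) * (+ 2 * (a * d * u)) ∎

    eK-ef : ∀ e f m u v → e * (u * f - m * v) ≡ u * (e * f) + m - m * (+ 1 + e * v)
    eK-ef = solve-∀

    simplify : ∀ a d m u → u * (m * m + + 4 * (a * a * d)) + m - m * (u * m) ≡
      m + + 2 * (+ 2 * (a * d * u) * a)
    simplify = solve-∀

    eK≡ : e * (u * f - m * v) ≡ m + + 2 * (+ 2 * (a * d * u) * a)
    eK≡ = begin
      e * (u * f - m * v)
        ≡⟨ eK-ef e f m u v ⟩
      u * (e * f) + m - m * (1ℤ + e * v)
        ≡⟨ cong₂ (λ x y → u * x + m - m * y) ef≡ (sym um≡1+ev) ⟩
      u * (m * m + + 4 * (a * a * d)) + m - m * (u * m)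
        ≡⟨ simplify a d m u ⟩
      m + + 2 * (+ 2 * (a * d * u) * a) ∎

    4deC-ce : ∀ a c d e → + 4 * (d * (e * (a * c))) ≡ + 4 * (a * (c * e) * d) - e + e
    4deC-ce = solve-∀

    rearrange : ∀ s a d e → s + + 4 * (a * a * d) + e ≡ s + + 4 * (d * (a * a)) + e
    rearrange = solve-∀

    4deC≡ : + 4 * (d * (e * (a * c))) ≡ m * m + + 4 * (d * (a * a)) + e
    4deC≡ = begin
      + 4 * (d * (e * (a * c)))               ≡⟨ 4deC-ce a c d e ⟩
      + 4 * (a * (c * e) * d) - e + e         ≡⟨ cong (_+ e) (sym (ef-ce a c d e)) ⟩
      e * f + e                               ≡⟨ cong (_+ e) ef≡ ⟩
      m * m + + 4 * (a * a * d) + e           ≡⟨ rearrange (m * m) a d e ⟩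
      m * m + + 4 * (d * (a * a)) + e         ∎

  -- Signed coefficients merge the two cases of Bézout's identity over ℕ: `m` is invertible modulo
  -- `e`.
  bézoutℤ : ∀ {m e} → Bézout.Identity 1 m e → ∃[ u ] ∃[ v ] u * + m ≡ 1ℤ + + e * v
  bézoutℤ {m} {e} (Bézout.+- u v 1+ve≡um) = + u , + v , (begin
    + u * + m               ≡⟨ pos-* u m ⟨
    + (u ℕ.* m)             ≡⟨ cong +_ 1+ve≡um ⟨
    1ℤ + + (v ℕ.* e)        ≡⟨ cong (_+_ 1ℤ) (pos-* v e) ⟩
    1ℤ + + v * + e          ≡⟨ cong (_+_ 1ℤ) (*-comm (+ v) (+ e)) ⟩
    1ℤ + + e * + v          ∎)
    where open ≡-Reasoning
  bézoutℤ {m} {e} (Bézout.-+ u v 1+um≡ve) = - + u , - + v , (begin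
    - + u * + m             ≡⟨ complement (+ u) (+ m) ⟩
    1ℤ - (1ℤ + + u * + m)   ≡⟨ cong (λ i → 1ℤ - (1ℤ + i)) (pos-* u m) ⟨
    1ℤ - + (1 ℕ.+ u ℕ.* m)  ≡⟨ cong (λ i → 1ℤ - + i) 1+um≡ve ⟩
    1ℤ - + (v ℕ.* e)        ≡⟨ cong (_-_ 1ℤ) (pos-* v e) ⟩
    1ℤ - + v * + e          ≡⟨ negate (+ v) (+ e) ⟩
    1ℤ + + e * - + v        ∎)
    where
    open ≡-Reasoning

    complement : ∀ u m → - u * m ≡ + 1 - (+ 1 + u * m)
    complement = solve-∀

    negate : ∀ v e → + 1 - v * e ≡ + 1 + e * - v
    negate = solve-∀

module Parametrisations where

  open TernaryForms using (¬4abd≡1+m²e; ¬4abd≡m²+e; bézoutℤ)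
  open import Data.Empty using (⊥)
  open import Data.Integer.Base as ℤ using (+_)
  import Data.Integer.Properties as ℤ
  open import Data.Nat.Base
  open import Data.Nat.Coprimality
    using (Coprime; coprime-divisor; coprime-Bézout; GCD≡1⇒coprime; 1-coprimeTo)
    renaming (sym to coprime-sym)
  open import Data.Nat.Divisibility
  open import Data.Nat.GCD using (GCD; module GCD; mkGCD; GCD-*)
  open import Data.Nat.Properties
  open import Data.Nat.Tactic.RingSolver using (solve-∀)
  open import Data.Product.Base using (_×_; _,_; ∃-syntax)
  open import Data.Rational.Base as ℚ using ()
  open import Data.Rational.Properties using (toℚᵘ-fromℚᵘ; toℚᵘ-homo-+; toℚᵘ-cong)
  open import Data.Rational.Unnormalised.Base as ℚᵘ using (mkℚᵘ)
  import Data.Rational.Unnormalised.Properties as ℚᵘ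
  open import Function.Base using (it)
  open import Relation.Binary.PropositionalEquality
  open import Relation.Nullary.Negation.Core using (¬_; contradiction)

  -- Coprimality and the extraction of common factors.

  coprime-factor : ∀ {m n d} → Coprime m n → d ∣ m → Coprime d n
  coprime-factor m⊥n d∣m (i∣d , i∣n) = m⊥n (∣-trans i∣d d∣m , i∣n)

  coprime-m+n : ∀ {m n} → Coprime m n → Coprime m (m + n)
  coprime-m+n m⊥n (i∣m , i∣m+n) = m⊥n (i∣m , ∣m+n∣m⇒∣n i∣m+n i∣m)

  odd⇒coprime-2 : ∀ {n} → 2 ∤ n → Coprime n 2
  odd⇒coprime-2 {n} 2∤n {d} (d∣n , d∣2) = ≤2⇒≡1 d (∣⇒≤ d∣2) d∣2 d∣n
    where
    ≤2⇒≡1 : ∀ d → d ≤ 2 → d ∣ 2 → d ∣ n → d ≡ 1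
    ≤2⇒≡1 0 _ 0∣2 _   = contradiction (0∣⇒≡0 0∣2) λ ()
    ≤2⇒≡1 1 _ _   _   = refl
    ≤2⇒≡1 2 _ _   2∣n = contradiction 2∣n 2∤n
    ≤2⇒≡1 (suc (suc (suc _))) (s≤s (s≤s ())) _ _

  coprime-∣* : ∀ {m n o} → Coprime m n → m ∣ o → n ∣ o → m * n ∣ o
  coprime-∣* {m} {n} m⊥n (divides q refl) n∣qm
    with coprime-divisor (coprime-sym m⊥n) (subst (n ∣_) (*-comm q m) n∣qm)
  ... | divides r refl = divides r (trans (*-assoc r n m) (cong (r *_) (*-comm n m)))

  gcd-cofactors : ∀ m n .{{_ : NonZero m}} →
    ∃[ a ] ∃[ b ] ∃[ g ] m ≡ a * g × n ≡ b * g × Coprime a b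
  gcd-cofactors m n with mkGCD m n
  ... | g , gcd with GCD.commonDivisor gcd
  ... | divides a refl , divides b refl = a , b , g , refl , refl ,
        GCD≡1⇒coprime (GCD-* {{m*n≢0⇒n≢0 a}} (subst (GCD (a * g) (b * g)) (sym (*-identityˡ g)) gcd))

  -- The shape of solutions of `4 = k/x + l/y + l/z`, where `y = acd` and `z = bcd`. The pair
  -- `(k, l)` is `(1, n)` if `n` divides `u₁`, and `(n, 1)` if `n` divides `u₂` and `u₃`.
  record Parametrisation (k l x : ℕ) : Set where
    field
      a b c d e    : ℕ
      {{d≢0}}      : NonZero d
      {{e≢0}}      : NonZero e
      x≡abd        : x ≡ a * b * d
      ce≡a+b       : c * e ≡ a + b
      4abd≡k+le    : 4 * (a * b * d) ≡ k + l * e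

  -- Factors are split off one at a time: `y = ag` and `z = bg` with `a`, `b` coprime, then
  -- `x = abd`, `g = cd` and `a + b = ec`. Each divisibility is read off the equation modulo the
  -- divisor, and the equation is cancelled before the next step.
  parametrise : ∀ {k l} x y z .{{_ : NonZero x}} .{{_ : NonZero y}} .{{_ : NonZero z}} →
    Coprime x k → Coprime y l → Coprime z l →
    4 * (x * (y * z)) ≡ k * (y * z) + l * (x * (y + z)) → Parametrisation k l x
  parametrise {k} {l} x y z x⊥k y⊥l z⊥l eq with gcd-cofactors y z
  ... | a , b , g , refl , refl , a⊥b = param ab∣x
    where
    instance
      _ = m*n≢0⇒m≢0 a {g}
      _ = m*n≢0⇒m≢0 b {g}
      _ = m*n≢0⇒n≢0 a {g}

    lhs-g : ∀ x a b g → 4 * (x * (a * g * (b * g))) ≡ 4 * (x * (a * b * g)) * g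
    lhs-g = solve-∀

    rhs-g : ∀ x a b g k l → k * (a * g * (b * g)) + l * (x * (a * g + b * g)) ≡
      (k * (a * b * g) + l * (x * (a + b))) * g
    rhs-g = solve-∀

    eq-g : 4 * (x * (a * b * g)) ≡ k * (a * b * g) + l * (x * (a + b))
    eq-g = *-cancelʳ-≡ _ _ g (trans (sym (lhs-g x a b g)) (trans eq (rhs-g x a b g k l)))

    ∣lx[a+b] : ∀ i → i ∣ a * b * g → i ∣ l * (x * (a + b))
    ∣lx[a+b] i i∣abg = ∣m+n∣m⇒∣n
      (subst (i ∣_) eq-g (∣n⇒∣m*n 4 (∣n⇒∣m*n x i∣abg))) (∣n⇒∣m*n k i∣abg)

    -- Applied to `a` and to `b`: each is coprime to `a + b` because they are coprime to each other.
    ∣x : ∀ i → Coprime i l → Coprime i (a + b) → i ∣ a * b * g → i ∣ x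
    ∣x i i⊥l i⊥a+b i∣abg = coprime-divisor i⊥a+b
      (subst (i ∣_) (*-comm x (a + b)) (coprime-divisor i⊥l (∣lx[a+b] i i∣abg)))

    ab∣x : a * b ∣ x
    ab∣x = coprime-∣* a⊥b
      (∣x a (coprime-factor y⊥l (m∣m*n g)) (coprime-m+n a⊥b) (∣m⇒∣m*n g (m∣m*n b)))
      (∣x b (coprime-factor z⊥l (m∣m*n g))
          (subst (Coprime b) (+-comm b a) (coprime-m+n (coprime-sym a⊥b)))
          (∣m⇒∣m*n g (n∣m*n a)))

    param : a * b ∣ x → Parametrisation k l x
    param (divides d refl) = paramG d∣g
      where
      instance
        _ = m*n≢0 a b
        _ = m*n≢0⇒m≢0 d {a * b}

      lhs-ab : ∀ n d g → 4 * (d * n * (n * g)) ≡ 4 * (n * d) * g * n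
      lhs-ab = solve-∀
      rhs-ab : ∀ n d g k l s → k * (n * g) + l * (d * n * s) ≡ (k * g + l * (d * s)) * n
      rhs-ab = solve-∀

      eq-ab : 4 * (a * b * d) * g ≡ k * g + l * (d * (a + b))
      eq-ab = *-cancelʳ-≡ _ _ (a * b)
        (trans (sym (lhs-ab (a * b) d g)) (trans eq-g (rhs-ab (a * b) d g k l (a + b))))

      -- In `eq-ab` every term but `kg` is visibly a multiple of `d`, and `d`, a divisor of `x`, is
      -- coprime to `k`.
      d∣g : d ∣ g
      d∣g = coprime-divisor (coprime-factor x⊥k (m∣m*n (a * b)))
        (∣m+n∣m⇒∣n
          (subst (d ∣_) (trans eq-ab (+-comm (k * g) _))
            (∣m⇒∣m*n g (∣n⇒∣m*n 4 (n∣m*n (a * b)))))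
          (∣n⇒∣m*n l (m∣m*n (a + b))))

      paramG : d ∣ g → Parametrisation k l x
      paramG (divides c refl) = paramC c∣a+b
        where
        instance _ = m*n≢0⇒m≢0 c {d}

        rhs-d : ∀ d c k l s → k * (c * d) + l * (d * s) ≡ (k * c + l * s) * d
        rhs-d = solve-∀

        eq-d : 4 * (a * b * d) * c ≡ k * c + l * (a + b)
        eq-d = *-cancelʳ-≡ _ _ d
          (trans (*-assoc (4 * (a * b * d)) c d) (trans eq-ab (rhs-d d c k l (a + b))))

        -- Modulo `c` only `l(a + b)` survives in `eq-d`, and `c`, a divisor of `y`, is coprime to
        -- `l`.
        c∣a+b : c ∣ a + b
        c∣a+b = coprime-divisor (coprime-factor y⊥l (∣n⇒∣m*n a (m∣m*n d)))
          (∣m+n∣m⇒∣n (subst (c ∣_) eq-d (n∣m*n (4 * (a * b * d)))) (n∣m*n k))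

        paramC : c ∣ a + b → Parametrisation k l x
        paramC (divides e a+b≡ec) = record
          { a = a ; b = b ; c = c ; d = d ; e = e
          ; d≢0 = it
          ; e≢0 = m*n≢0⇒m≢0 e {c} {{subst NonZero a+b≡ec a+b≢0}}
          ; x≡abd = *-comm d (a * b)
          ; ce≡a+b = trans (*-comm c e) (sym a+b≡ec)
          ; 4abd≡k+le = *-cancelʳ-≡ _ _ c (trans eq-d
              (trans (cong (λ s → k * c + l * s) a+b≡ec) (rhs-c k l e c)))
          }
          where
          a+b≢0 : NonZero (a + b)
          a+b≢0 = >-nonZero (≤-trans (>-nonZero⁻¹ a) (m≤m+n a b))

          rhs-c : ∀ k l e c → k * c + l * (e * c) ≡ (k + l * e) * c
          rhs-c = solve-∀

  -- Contradictions from the parametrisation when `n` is a square.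

  module _ {k l x : ℕ} (P : Parametrisation k l x) where
    open Parametrisation P

    private
      +d>0 : + 0 ℤ.< + d
      +d>0 = ℤ.+<+ (>-nonZero⁻¹ d)

      +e>0 : + 0 ℤ.< + e
      +e>0 = ℤ.+<+ (>-nonZero⁻¹ e)

      +ce≡ : + c ℤ.* + e ≡ + a ℤ.+ + b
      +ce≡ = trans (sym (ℤ.pos-* c e)) (cong +_ ce≡a+b)

      +4abd≡ : + 4 ℤ.* (+ a ℤ.* + b ℤ.* + d) ≡ + k ℤ.+ + l ℤ.* + e
      +4abd≡ = begin
        + 4 ℤ.* (+ a ℤ.* + b ℤ.* + d)  ≡⟨ cong (λ i → + 4 ℤ.* (i ℤ.* + d)) (ℤ.pos-* a b) ⟨
        + 4 ℤ.* (+ (a * b) ℤ.* + d)    ≡⟨ cong (+ 4 ℤ.*_) (ℤ.pos-* (a * b) d) ⟨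
        + 4 ℤ.* + (a * b * d)          ≡⟨ ℤ.pos-* 4 (a * b * d) ⟨
        + (4 * (a * b * d))            ≡⟨ cong +_ 4abd≡k+le ⟩
        + k ℤ.+ + (l * e)              ≡⟨ cong (ℤ._+_ (+ k)) (ℤ.pos-* l e) ⟩
        + k ℤ.+ + l ℤ.* + e            ∎
        where open ≡-Reasoning

      pos-^2 : ∀ m → + (m ^ 2) ≡ + m ℤ.* + m
      pos-^2 m = trans (cong (λ i → + (m * i)) (*-identityʳ m)) (ℤ.pos-* m m)

    ¬parametrisation-1,m² : ∀ m → k ≡ 1 → l ≡ m ^ 2 → ⊥
    ¬parametrisation-1,m² m refl refl =
      ¬4abd≡1+m²e {+ a} {+ b} {+ c} {m = + m} +d>0 +e>0 +ce≡
        (trans +4abd≡ (cong (λ i → + 1 ℤ.+ i ℤ.* + e) (pos-^2 m)))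

    ¬parametrisation-m²,1 : ∀ m → k ≡ m ^ 2 → l ≡ 1 → 2 ∤ k → Coprime x k → ⊥
    ¬parametrisation-m²,1 m refl refl 2∤m² x⊥m² =
      contradict (bézoutℤ (coprime-Bézout m⊥e))
      where
      -- A common divisor of `m` and `e` divides `4abd = m² + e`. It is odd, so the 4 can be removed
      -- as two factors 2; it then divides `x`, which is coprime to `m²`.
      m⊥e : Coprime m e
      m⊥e {i} (i∣m , i∣e) = x⊥m² (subst (i ∣_) (sym x≡abd) i∣abd , i∣m²)
        where
        i∣m² : i ∣ m ^ 2
        i∣m² = ∣m⇒∣m*n (m * 1) i∣m

        i⊥2 : Coprime i 2
        i⊥2 = coprime-factor (odd⇒coprime-2 2∤m²) i∣m²

        i∣abd : i ∣ a * b * d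
        i∣abd = coprime-divisor i⊥2 (coprime-divisor i⊥2
          (subst (i ∣_) (trans (sym 4abd≡k+le) (*-assoc 2 2 (a * b * d)))
            (∣m∣n⇒∣m+n i∣m² (∣n⇒∣m*n 1 i∣e))))

      contradict : ¬ (∃[ u ] ∃[ v ] u ℤ.* + m ≡ + 1 ℤ.+ + e ℤ.* v)
      contradict (u , v , um≡1+ev) =
        ¬4abd≡m²+e {+ a} {+ b} {+ c} {m = + m} {u} {v} +d>0 +e>0 um≡1+ev +ce≡
          (trans +4abd≡ (cong₂ ℤ._+_ (pos-^2 m) (ℤ.*-identityˡ (+ e))))

  -- From unit fractions to the two divisibility cases.

  clear-denominators : ∀ n u₁ u₂ u₃
    .{{_ : NonZero n}} .{{_ : NonZero u₁}} .{{_ : NonZero u₂}} .{{_ : NonZero u₃}} →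
    + 4 ℚ./ n ≡ + 1 ℚ./ u₁ ℚ.+ + 1 ℚ./ u₂ ℚ.+ + 1 ℚ./ u₃ →
    4 * (u₁ * (u₂ * u₃)) ≡ n * (u₂ * u₃ + u₁ * (u₂ + u₃))
  clear-denominators n@(suc n-1) u₁@(suc u₁-1) u₂@(suc u₂-1) u₃@(suc u₃-1) eq =
    trans (lhs u₁ u₂ u₃) (trans (ℤ.+-injective (ℚᵘ.drop-*≡* eqᵘ)) (rhs n u₁ u₂ u₃))
    where
    p₁ = mkℚᵘ (+ 1) u₁-1
    p₂ = mkℚᵘ (+ 1) u₂-1
    p₃ = mkℚᵘ (+ 1) u₃-1

    -- Unnormalised fractions add without reduction to lowest terms, so equality there unfolds to
    -- cross-multiplication of explicit numerators and denominators.
    eqᵘ : mkℚᵘ (+ 4) n-1 ℚᵘ.≃ p₁ ℚᵘ.+ p₂ ℚᵘ.+ p₃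
    eqᵘ = begin
      mkℚᵘ (+ 4) n-1
        ≈⟨ toℚᵘ-fromℚᵘ (mkℚᵘ (+ 4) n-1) ⟨
      ℚ.toℚᵘ (+ 4 ℚ./ n)
        ≈⟨ toℚᵘ-cong eq ⟩
      ℚ.toℚᵘ (+ 1 ℚ./ u₁ ℚ.+ + 1 ℚ./ u₂ ℚ.+ + 1 ℚ./ u₃)
        ≈⟨ toℚᵘ-homo-+ (+ 1 ℚ./ u₁ ℚ.+ + 1 ℚ./ u₂) (+ 1 ℚ./ u₃) ⟩
      ℚ.toℚᵘ (+ 1 ℚ./ u₁ ℚ.+ + 1 ℚ./ u₂) ℚᵘ.+ ℚ.toℚᵘ (+ 1 ℚ./ u₃)
        ≈⟨ ℚᵘ.+-cong (toℚᵘ-homo-+ (+ 1 ℚ./ u₁) (+ 1 ℚ./ u₂)) (toℚᵘ-fromℚᵘ p₃) ⟩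
      ℚ.toℚᵘ (+ 1 ℚ./ u₁) ℚᵘ.+ ℚ.toℚᵘ (+ 1 ℚ./ u₂) ℚᵘ.+ p₃
        ≈⟨ ℚᵘ.+-congˡ p₃ (ℚᵘ.+-cong (toℚᵘ-fromℚᵘ p₁) (toℚᵘ-fromℚᵘ p₂)) ⟩
      p₁ ℚᵘ.+ p₂ ℚᵘ.+ p₃ ∎
      where open import Relation.Binary.Reasoning.Setoid ℚᵘ.≃-setoid

    lhs : ∀ x y z → 4 * (x * (y * z)) ≡ 4 * (x * y * z)
    lhs = solve-∀

    rhs : ∀ n x y z → ((1 * y + 1 * x) * z + 1 * (x * y)) * n ≡ n * (y * z + x * (y + z))
    rhs = solve-∀

  -- Writing `u₁ = xn` and cancelling one factor `n` leaves the equation of `parametrise` with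
  -- `k = 1` and `l = n`.
  ¬solution-n∣u₁ : ∀ {n} m → n ≡ m ^ 2 → ∀ u₁ u₂ u₃
    .{{_ : NonZero n}} .{{_ : NonZero u₁}} .{{_ : NonZero u₂}} .{{_ : NonZero u₃}} →
    n ∣ u₁ → Coprime n (u₂ * u₃) → ¬ 4 * (u₁ * (u₂ * u₃)) ≡ n * (u₂ * u₃ + u₁ * (u₂ + u₃))
  ¬solution-n∣u₁ {n} m n≡m² _ u₂ u₃ (divides x refl) n⊥u₂u₃ eq =
    ¬parametrisation-1,m²
      (parametrise x u₂ u₃ (coprime-sym (1-coprimeTo x))
        (coprime-factor (coprime-sym n⊥u₂u₃) (m∣m*n u₃))
        (coprime-factor (coprime-sym n⊥u₂u₃) (n∣m*n u₂))
        (*-cancelʳ-≡ _ _ n (trans (lhs n x u₂ u₃) (trans eq (rhs n x u₂ u₃)))))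
      m refl n≡m²
    where
    instance _ = m*n≢0⇒m≢0 x {n}

    lhs : ∀ n x y z → 4 * (x * (y * z)) * n ≡ 4 * (x * n * (y * z))
    lhs = solve-∀

    rhs : ∀ n x y z → n * (y * z + x * n * (y + z)) ≡ (1 * (y * z) + n * (x * (y + z))) * n
    rhs = solve-∀

  -- Writing `u₂ = yn` and `u₃ = zn` and cancelling `n²` leaves the equation of `parametrise` with
  -- `k = n` and `l = 1`.
  ¬solution-n∣u₂,u₃ : ∀ {n} m → n ≡ m ^ 2 → 2 ∤ n → ∀ u₁ u₂ u₃
    .{{_ : NonZero n}} .{{_ : NonZero u₁}} .{{_ : NonZero u₂}} .{{_ : NonZero u₃}} →
    Coprime n u₁ → n ∣ u₂ → n ∣ u₃ →
    ¬ 4 * (u₁ * (u₂ * u₃)) ≡ n * (u₂ * u₃ + u₁ * (u₂ + u₃))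
  ¬solution-n∣u₂,u₃ {n} m n≡m² 2∤n u₁ _ _ n⊥u₁ (divides y refl) (divides z refl) eq =
    ¬parametrisation-m²,1
      (parametrise u₁ y z (coprime-sym n⊥u₁)
        (coprime-sym (1-coprimeTo y)) (coprime-sym (1-coprimeTo z))
        (*-cancelʳ-≡ _ _ (n * n) (trans (lhs n u₁ y z) (trans eq (rhs n u₁ y z)))))
      m n≡m² refl 2∤n (coprime-sym n⊥u₁)
    where
    instance
      _ = m*n≢0⇒m≢0 y {n}
      _ = m*n≢0⇒m≢0 z {n}
      _ = m*n≢0 n n

    lhs : ∀ n x y z → 4 * (x * (y * z)) * (n * n) ≡ 4 * (x * (y * n * (z * n)))
    lhs = solve-∀

    rhs : ∀ n x y z → n * (y * n * (z * n) + x * (y * n + z * n)) ≡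
      (n * (y * z) + 1 * (x * (y + z))) * (n * n)
    rhs = solve-∀

open import Defs
open import Data.Nat.Base using (ℕ; NonZero; _^_) renaming (_*_ to _*ℕ_)
open import Data.Nat.Coprimality using (gcd≡1⇒coprime)
open import Data.Nat.Divisibility using (_∣_; _∤_)
open import Data.Nat.GCD using (gcd)
open import Data.Integer.Base using (+_)
open import Data.Rational.Base using (_/_; _+_)
open import Data.Product.Base using (_×_; _,_; ∃-syntax)
open import Data.Sum.Base using (_⊎_; inj₁; inj₂)
open import Relation.Nullary.Negation.Core using (¬_)
open import Relation.Binary.PropositionalEquality.Core using (_≡_)
open Parametrisations using (clear-denominators; ¬solution-n∣u₁; ¬solution-n∣u₂,u₃)

corollary1p4 : (n : ℕ) .{{_ : NonZero n}} → 2 ∤ n → (∃[ m ] n ≡ m ^ 2) →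
    (u₁ u₂ u₃ : ℕ) .{{_ : NonZero u₁}} .{{_ : NonZero u₂}} .{{_ : NonZero u₃}} →
    ¬ ((+ 4 / n ≡ + 1 / u₁ + + 1 / u₂ + + 1 / u₃)
    × ((n ∣ u₁ × gcd n (u₂ *ℕ u₃) ≡ 1)
    ⊎ (gcd n u₁ ≡ 1 × n ∣ u₂ × n ∣ u₃)))
corollary1p4 n 2∤n (m , n≡m²) u₁ u₂ u₃ (eq , inj₁ (n∣u₁ , gcd≡1)) =
  ¬solution-n∣u₁ m n≡m² u₁ u₂ u₃ n∣u₁ (gcd≡1⇒coprime gcd≡1) (clear-denominators n u₁ u₂ u₃ eq)
corollary1p4 n 2∤n (m , n≡m²) u₁ u₂ u₃ (eq , inj₂ (gcd≡1 , n∣u₂ , n∣u₃)) =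
  ¬solution-n∣u₂,u₃ m n≡m² 2∤n u₁ u₂ u₃ (gcd≡1⇒coprime gcd≡1) n∣u₂ n∣u₃
    (clear-denominators n u₁ u₂ u₃ eq)
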